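{- Let $(S,K,I)$ be a homogeneous split graph and $\Phi=\Phi(S)$. Then: (1) for distinct $u,v\in I$, $\sigma_{uv}(S)=0$ if and only if $u$ and $v$ are twins in $S$; (2) $\sigma_{uv}(S)$ is a perfect square for every pair of distinct $u,v\in I$; (3) $\deg(S)\ge1$; in particular, if $d$ denotes the common degree in $S$ of the vertices of $I$, then $d\notin\{0,|K|\}$; (4) $\Phi$ has no induced subgraph isomorphic to $K_2\,\dot\cup\,K_1$; (5) $\operatorname{diam}(\Phi)\le 2$ (in particular $\Phi$ is connected); (6) $\Phi$ contains no induced cycle of length $5$ or more.
   Context: All graphs are finite and simple. A split graph is a graph $S$ whose vertex set is a disjoint union $V(S)=K\,\dot\cup\,I$ with $K$ a clique and $I$ an independent set; $(K,I)$ is called a bipartition of $S$, and $(S,K,I)$ denotes $S$ together with this fixed bipartition. For a split graph $(S,K,I)$ and distinct $u,v\in I$, $\sigma_{uv}(S)$ is the number of induced subgraphs of $S$ isomorphic to $P_4$ containing both $u$ and $v$. The factor graph $\Phi(S)$ is the loopless multigraph with vertex set $I$ having exactly $\sigma_{uv}(S)$ parallel edges between $u$ and $v$. Graph notions (connected, complete, clique, diameter, induced subgraph, etc.) applied to $\Phi(S)$ refer to its underlying simple graph, in which $u\sim v$ iff $\sigma_{uv}(S)\ge1$. $\deg(S)$ denotes the number of induced subgraphs of $S$ isomorphic to $P_4$ (equivalently the number of edges of $\Phi(S)$ counted with multiplicity). Two vertices $u,v$ of a graph $G$ are twins if $N_G(u)\setminus\{v\}=N_G(v)\setminus\{u\}$.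 A vertex $w$ of $(S,K,I)$ is swing if $N_S(w)=K\setminus\{w\}$. $(S,K,I)$ is balanced if $|K|=\omega(S)$ and $|I|=\alpha(S)$; it is known that $S$ is balanced iff it has no swing vertex. $(S,K,I)$ is homogeneous if it is balanced and all vertices of $I$ have the same degree in $S$. -}

module Defs where

open import Data.Empty using (⊥-elim)
open import Data.Fin using (Fin; zero; suc; toℕ)
open import Data.Fin.Properties using (_≟_; any?; all?)
open import Data.Fin.Subset using (Subset; _∈_; _∪_; _∩_; ⊤; ⊥; ∣_∣; inside; outside)
  renaming (_-_ to _∖⁅_⁆)
open import Data.Fin.Subset.Properties using (_∈?_)
open import Data.List using (List; []; _∷_; _++_; map; filter; length)
open import Data.List.Properties using (filter-≐)
open import Data.Nat using (ℕ; zero; suc; _≤_; _≤?_; ∣_-_∣)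
open import Data.Nat.Properties using (∣n-n∣≡0; ∣-∣-comm) renaming (_≟_ to _≟ℕ_)
open import Data.Product using (Σ; ∃; _×_; _,_)
open import Data.Sum using (_⊎_; inj₁; inj₂) renaming (map to map⊎)
open import Data.Sum.Relation.Binary.Pointwise using (Pointwise; inj₁; inj₂; ⊎-symmetric; ⊎-decidable)
open import Data.Vec using (Vec; []; _∷_; lookup; tabulate)
open import Data.Vec.Properties using (lookup∘tabulate)
open import Function using (_∘_; _⇔_; mk⇔; Equivalence; Injective)
open import Level using (0ℓ)
open import Relation.Binary using (Rel; Symmetric; Decidable)
open import Relation.Binary.PropositionalEquality
  using (_≡_; _≢_; _≗_; refl; sym; trans; cong; subst; subst₂; ≢-sym)
open import Relation.Nullary using (¬_; Dec; yes; no; does; ¬?)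
open import Relation.Nullary.Decidable using (map′; _×-dec_; _→-dec_; _⊎-dec_)
import Relation.Unary as U

record Graph (V : Set) : Set₁ where
  infix 4 _~_ _~?_
  field
    _~_     : Rel V 0ℓ
    ~-sym   : Symmetric _~_
    ~-irrefl : ∀ v → ¬ (v ~ v)
    _~?_    : Decidable _~_

Complete : (k : ℕ) → Graph (Fin k)
Complete k = record
  { _~_      = _≢_
  ; ~-sym    = ≢-sym
  ; ~-irrefl = λ _ i≢i → i≢i refl
  ; _~?_     = λ i j → ¬? (i ≟ j)
  }

Path : (k : ℕ) → Graph (Fin k)
Path k = record
  { _~_      = λ i j → ∣ toℕ i - toℕ j ∣ ≡ 1
  ; ~-sym    = λ {i} {j} p → trans (∣-∣-comm (toℕ j) (toℕ i)) p
  ; ~-irrefl = λ i p → 0≢1 (trans (sym (∣n-n∣≡0 (toℕ i))) p)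
  ; _~?_     = λ i j → ∣ toℕ i - toℕ j ∣ ≟ℕ 1
  }
  where
  0≢1 : 0 ≢ 1
  0≢1 ()

-- The cycle 0, 1, …, k-1, 0.  This is a genuine cycle only for 3 ≤ k;
-- the condition i ≢ j merely keeps Cycle 1 loopless.
Cycle : (k : ℕ) → Graph (Fin k)
Cycle k = record
  { _~_      = λ i j → i ≢ j × (∣ toℕ i - toℕ j ∣ ≡ 1 ⊎ suc ∣ toℕ i - toℕ j ∣ ≡ k)
  ; ~-sym    = λ {i} {j} (i≢j , p) →
      let c = ∣-∣-comm (toℕ j) (toℕ i) in
      ≢-sym i≢j , map⊎ (trans c) (trans (cong suc c)) p
  ; ~-irrefl = λ _ (i≢i , _) → i≢i refl
  ; _~?_     = λ i j → ¬? (i ≟ j) ×-dec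
      ((∣ toℕ i - toℕ j ∣ ≟ℕ 1) ⊎-dec (suc ∣ toℕ i - toℕ j ∣ ≟ℕ k))
  }

infixr 6 _∪̇_
_∪̇_ : {V W : Set} → Graph V → Graph W → Graph (V ⊎ W)
G ∪̇ H = record
  { _~_      = Pointwise G._~_ H._~_
  ; ~-sym    = ⊎-symmetric G.~-sym H.~-sym
  ; ~-irrefl = λ { (inj₁ v) (inj₁ e) → G.~-irrefl v e
                 ; (inj₂ w) (inj₂ e) → H.~-irrefl w e }
  ; _~?_     = ⊎-decidable G._~?_ H._~?_
  }
  where
  module G = Graph G
  module H = Graph H

IsMaximum : (ℕ → Set) → ℕ → Set
IsMaximum P m = P m × (∀ k → P k → k ≤ m)

IsMinimum : (ℕ → Set) → ℕ → Set
IsMinimum P m = P m × (∀ k → P k → m ≤ k)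

IsInducedEmbedding : {W V : Set} → Graph W → Graph V → (W → V) → Set
IsInducedEmbedding H G f =
  Injective _≡_ _≡_ f × (∀ i j → Graph._~_ H i j ⇔ Graph._~_ G (f i) (f j))

HasInducedSubgraph : {W V : Set} → Graph V → Graph W → Set
HasInducedSubgraph {W} {V} G H = Σ (W → V) (IsInducedEmbedding H G)

data Walk {V : Set} (G : Graph V) : V → V → ℕ → Set where
  []  : ∀ {v} → Walk G v v 0
  _∷_ : ∀ {u v w ℓ} → Graph._~_ G u v → Walk G v w ℓ → Walk G u w (suc ℓ)

Connected : {V : Set} → Graph V → Set
Connected G = ∀ u v → ∃ λ ℓ → Walk G u v ℓ

IsDistance : {V : Set} → Graph V → V → V → ℕ → Set
IsDistance G u v = IsMinimum (Walk G u v)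

-- Finite diameter D: all distances exist, and D is the largest of them.
IsDiameter : {V : Set} → Graph V → ℕ → Set
IsDiameter G D =
  Connected G × IsMaximum (λ d → ∃ λ u → ∃ λ v → IsDistance G u v d) D

module _ {n : ℕ} (G : Graph (Fin n)) where
  open Graph G

  N : Fin n → Subset n
  N v = tabulate (λ w → does (v ~? w))

  degree : Fin n → ℕ
  degree v = ∣ N v ∣

  Twins : Fin n → Fin n → Set
  Twins u v = N u ∖⁅ v ⁆ ≡ N v ∖⁅ u ⁆

  IsClique : Subset n → Set
  IsClique X = ∀ u v → u ∈ X → v ∈ X → u ≢ v → u ~ v

  IsIndependent : Subset n → Set
  IsIndependent X = ∀ u v → u ∈ X → v ∈ X → ¬ (u ~ v)

  IsCliqueNumber : ℕ → Set
  IsCliqueNumber = IsMaximum (λ k → ∃ λ X → IsClique X × ∣ X ∣ ≡ k)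

  IsIndependenceNumber : ℕ → Set
  IsIndependenceNumber = IsMaximum (λ k → ∃ λ X → IsIndependent X × ∣ X ∣ ≡ k)

  -- The subgraph of G induced on X is isomorphic to H: the isomorphism is
  -- presented as an induced embedding of H into G with image X.
  InducedOn : {k : ℕ} → Graph (Fin k) → Subset n → Set
  InducedOn {k} H X = Σ (Fin k → Fin n) λ f →
    IsInducedEmbedding H G f × (∀ v → v ∈ X ⇔ ∃ λ i → f i ≡ v)

private
  _⇔-dec_ : {A B : Set} → Dec A → Dec B → Dec (A ⇔ B)
  a? ⇔-dec b? = map′ (λ (f , g) → mk⇔ f g) (λ e → Equivalence.to e , Equivalence.from e)
                     ((a? →-dec b?) ×-dec (b? →-dec a?))

  anyVec? : ∀ {n} k {P : Vec (Fin n) k → Set} → U.Decidable P → Dec (∃ P)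
  anyVec? zero    P? = map′ (λ p → [] , p) (λ { ([] , p) → p }) (P? [])
  anyVec? (suc k) P? =
    map′ (λ (x , xs , p) → (x ∷ xs) , p) (λ { (x ∷ xs , p) → x , xs , p })
         (any? λ x → anyVec? k λ xs → P? (x ∷ xs))

  anyFun? : ∀ {n} k {P : (Fin k → Fin n) → Set} →
            (∀ {f g} → f ≗ g → P f → P g) → U.Decidable P → Dec (∃ P)
  anyFun? k resp P? =
    map′ (λ (xs , p) → lookup xs , p)
         (λ (f , p) → tabulate f , resp (sym ∘ lookup∘tabulate f) p)
         (anyVec? k (P? ∘ lookup))

inducedOn? : ∀ {n k} (G : Graph (Fin n)) (H : Graph (Fin k)) → U.Decidable (InducedOn G H)
inducedOn? {n} {k} G H X = anyFun? k resp dec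
  where
  module G = Graph G
  module H = Graph H

  P : (Fin k → Fin n) → Set
  P f = IsInducedEmbedding H G f × (∀ v → v ∈ X ⇔ ∃ λ i → f i ≡ v)

  resp : ∀ {f g} → f ≗ g → P f → P g
  resp f≗g ((inj , adj) , im) =
    ( (λ {i} {j} e → inj (trans (f≗g i) (trans e (sym (f≗g j)))))
    , (λ i j → subst₂ (λ a b → H._~_ i j ⇔ G._~_ a b) (f≗g i) (f≗g j) (adj i j)) )
    , λ v → mk⇔ (λ v∈X → let (i , e) = Equivalence.to (im v) v∈X in i , trans (sym (f≗g i)) e)
                (λ (i , e) → Equivalence.from (im v) (i , trans (f≗g i) e))

  dec : U.Decidable P
  dec f = (map′ (λ h {i} {j} → h i j) (λ h i j → h {i} {j})
             (all? λ i → all? λ j → (f i ≟ f j) →-dec (i ≟ j))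
           ×-dec (all? λ i → all? λ j → (i H.~? j) ⇔-dec (f i G.~? f j)))
          ×-dec (all? λ v → (v ∈? X) ⇔-dec any? λ i → f i ≟ v)

allSubsets : (n : ℕ) → List (Subset n)
allSubsets zero    = [] ∷ []
allSubsets (suc n) = map (inside ∷_) (allSubsets n) ++ map (outside ∷_) (allSubsets n)

#Subsets : {n : ℕ} {P : Subset n → Set} → U.Decidable P → ℕ
#Subsets {n} P? = length (filter P? (allSubsets n))

record Multigraph (V : Set) : Set where
  field
    mult     : V → V → ℕ
    mult-sym : ∀ u v → mult u v ≡ mult v u
    loopless : ∀ v → mult v v ≡ 0

underlying : {V : Set} → Multigraph V → Graph V
underlying M = record
  { _~_      = λ u v → 1 ≤ mult u v
  ; ~-sym    = λ {u} {v} p → subst (1 ≤_) (mult-sym u v) p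
  ; ~-irrefl = λ v p → 1≰0 (subst (1 ≤_) (loopless v) p)
  ; _~?_     = λ u v → 1 ≤? mult u v
  }
  where
  open Multigraph M
  1≰0 : ¬ (1 ≤ 0)
  1≰0 ()

record SplitGraph (n : ℕ) : Set₁ where
  field
    graph         : Graph (Fin n)
    K I           : Subset n
    covers        : K ∪ I ≡ ⊤
    disjoint      : K ∩ I ≡ ⊥
    K-clique      : IsClique graph K
    I-independent : IsIndependent graph I

  Balanced : Set
  Balanced = IsCliqueNumber graph ∣ K ∣ × IsIndependenceNumber graph ∣ I ∣

  Homogeneous : Set
  Homogeneous = Balanced × (∀ u v → u ∈ I → v ∈ I → degree graph u ≡ degree graph v)

  deg : ℕ
  deg = #Subsets (inducedOn? graph (Path 4))

  σ? : (u v : Fin n) → U.Decidable (λ X → (u ∈ X × v ∈ X) × InducedOn graph (Path 4) X)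
  σ? u v X = ((u ∈? X) ×-dec (v ∈? X)) ×-dec inducedOn? graph (Path 4) X

  σ : Fin n → Fin n → ℕ
  σ u v = #Subsets (σ? u v)

  σ-sym : ∀ u v → σ u v ≡ σ v u
  σ-sym u v = cong length (filter-≐ (σ? u v) (σ? v u) (swap , swap) (allSubsets n))
    where
    swap : ∀ {A B C : Set} → (A × B) × C → (B × A) × C
    swap ((a , b) , c) = (b , a) , c

  -- σ is only meaningful on distinct vertices, hence the case distinction.
  factorGraph : Multigraph (∃ λ v → v ∈ I)
  factorGraph = record { mult = mult ; mult-sym = mult-sym ; loopless = loopless }
    where
    mult : (u v : ∃ λ v → v ∈ I) → ℕ
    mult (u , _) (v , _) with u ≟ v
    ... | yes _ = 0
    ... | no  _ = σ u v

    mult-sym : ∀ u v → mult u v ≡ mult v u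
    mult-sym (u , _) (v , _) with u ≟ v | v ≟ u
    ... | yes _   | yes _   = refl
    ... | yes u≡v | no  v≢u = ⊥-elim (v≢u (sym u≡v))
    ... | no  u≢v | yes v≡u = ⊥-elim (u≢v (sym v≡u))
    ... | no  _   | no  _   = σ-sym u v

    loopless : ∀ v → mult v v ≡ 0
    loopless (v , _) with v ≟ v
    ... | yes _   = refl
    ... | no  v≢v = ⊥-elim (v≢v refl)

  Φ : Graph (∃ λ v → v ∈ I)
  Φ = underlying factorGraph

{-# OPTIONS --safe #-}
module Submission where

-- An induced P₄ of a split graph has its inner vertices in K and its ends in I.
-- Hence the P₄s through u, v ∈ I are the paths u a b v with a ∈ N u ∖ N v and
-- b ∈ N v ∖ N u chosen arbitrarily.  When u and v have the same degree these two
-- differences have the same size m, so σ u v = m², and u, v are adjacent in Φ iff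
-- N u ≢ N v: Φ is complete multipartite.  Balancedness says that no vertex is
-- swing, so for u ∈ I some k ∈ K misses u and is hit by some w ∈ I; then
-- N w ≢ N u, and Φ has at least two parts.

open import Defs
import Data.Bool.Properties as Bool
open import Data.Empty using (⊥-elim)
open import Data.Fin using (Fin; zero; suc; opposite)
open import Data.Fin.Patterns using (0F; 1F; 2F; 3F)
open import Data.Fin.Properties using (any?; suc-injective) renaming (_≟_ to _≟F_)
open import Data.Fin.Subset using (Subset; _∈_; _∉_; _∪_; _∩_; ∁; ⊥; ⁅_⁆; ∣_∣; inside; outside; Nonempty)
  renaming (_-_ to _∖⁅_⁆)
open import Data.Fin.Subset.Properties
open import Data.List using (List; []; _∷_; map; filter; length; cartesianProduct)
open import Data.List.Membership.Propositional using () renaming (_∈_ to _∈ₗ_)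
open import Data.List.Membership.Propositional.Properties using
  ( ∈-map⁺; ∈-map⁻; ∈-++⁺ˡ; ∈-++⁺ʳ; ∈-filter⁺; ∈-filter⁻; ∈-cartesianProduct⁺; ∈-cartesianProduct⁻)
open import Data.List.Membership.Propositional.Properties.WithK using (unique∧set⇒bag)
open import Data.List.Properties using (length-map; length-++)
open import Data.List.Relation.Binary.BagAndSetEquality using (∼bag⇒↭)
open import Data.List.Relation.Binary.Permutation.Propositional.Properties using (↭-length)
open import Data.List.Relation.Unary.All as All using ([]; _∷_)
import Data.List.Relation.Unary.All.Properties as All
open import Data.List.Relation.Unary.AllPairs using ([]; _∷_)
open import Data.List.Relation.Unary.Any using (here; there)
open import Data.List.Relation.Unary.Unique.Propositional using (Unique)
open import Data.List.Relation.Unary.Unique.Propositional.Properties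
  using (map⁺; ++⁺; filter⁺; cartesianProduct⁺)
open import Data.Nat using (ℕ; zero; suc; NonZero; z≤n; s≤s; _+_; _*_; _≤_; _<_; _^_)
open import Data.Nat.Properties using
  ( +-suc; +-cancelˡ-≡; *-identityʳ; m*n≡0⇒m≡0∨n≡0; n>0⇒n≢0; n≢0⇒n>0; <⇒≱; <⇒≢; n≮0
  ; ≤-refl; ≤-trans)
open import Data.Product using (∃; _×_; _,_; proj₁; proj₂)
open import Data.Sum using (_⊎_; inj₁; inj₂; [_,_]′)
open import Data.Sum.Relation.Binary.Pointwise using (inj₁; inj₂)
open import Data.Vec using ([]; _∷_; lookup; tabulate)
open import Data.Vec.Properties using (lookup∘tabulate; []=⇒lookup; lookup⇒[]=; ≡-dec)
open import Data.Vec.Properties.WithK using ([]=-irrelevant)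
open import Function using (_∘_; _⇔_; mk⇔; Equivalence)
open import Function.Construct.Composition using (_⇔-∘_)
open import Function.Construct.Symmetry using (⇔-sym)
open import Relation.Binary.Definitions using (DecidableEquality)
open import Relation.Binary.PropositionalEquality
open import Relation.Nullary using (¬_; yes; no; does; ¬?; contradiction)
open import Relation.Nullary.Decidable using (_×-dec_; dec-true; decidable-stable)
import Relation.Unary as U

private
  variable
    n k : ℕ

-- Finite subsets: membership, differences and cardinalities

module _ {P : Fin n → Set} (P? : U.Decidable P) where

  -- Both the neighbourhoods `N` and the sets `image f` are tabulated decisions, so this pair of
  -- lemmas serves for both.
  ∈-tabulate⁺ : ∀ {v} → P v → v ∈ tabulate (does ∘ P?)
  ∈-tabulate⁺ {v} p = lookup⇒[]= v _ (trans (lookup∘tabulate _ v) (dec-true (P? v) p))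

  ∈-tabulate⁻ : ∀ {v} → v ∈ tabulate (does ∘ P?) → P v
  ∈-tabulate⁻ {v} v∈ with P? v | trans (sym (lookup∘tabulate (does ∘ P?) v)) ([]=⇒lookup v∈)
  ... | yes p | _ = p
  ... | no _  | ()

_≟ˢ_ : DecidableEquality (Subset n)
_≟ˢ_ = ≡-dec Bool._≟_

∣p∣≡∣p∩q∣+∣p∩∁q∣ : (p q : Subset n) → ∣ p ∣ ≡ ∣ p ∩ q ∣ + ∣ p ∩ ∁ q ∣
∣p∣≡∣p∩q∣+∣p∩∁q∣ []            []            = refl
∣p∣≡∣p∩q∣+∣p∩∁q∣ (outside ∷ p) (_ ∷ q)       = ∣p∣≡∣p∩q∣+∣p∩∁q∣ p q
∣p∣≡∣p∩q∣+∣p∩∁q∣ (inside ∷ p)  (inside ∷ q)  = cong suc (∣p∣≡∣p∩q∣+∣p∩∁q∣ p q)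
∣p∣≡∣p∩q∣+∣p∩∁q∣ (inside ∷ p)  (outside ∷ q) =
  trans (cong suc (∣p∣≡∣p∩q∣+∣p∩∁q∣ p q)) (sym (+-suc _ _))

-- Both sets split off the same part `p ∩ q`, which cancels.
∣p∣≡∣q∣⇒∣p∩∁q∣≡∣q∩∁p∣ : (p q : Subset n) → ∣ p ∣ ≡ ∣ q ∣ → ∣ p ∩ ∁ q ∣ ≡ ∣ q ∩ ∁ p ∣
∣p∣≡∣q∣⇒∣p∩∁q∣≡∣q∩∁p∣ p q eq = +-cancelˡ-≡ ∣ p ∩ q ∣ _ _ (begin
  ∣ p ∩ q ∣ + ∣ p ∩ ∁ q ∣  ≡⟨ ∣p∣≡∣p∩q∣+∣p∩∁q∣ p q ⟨
  ∣ p ∣                    ≡⟨ eq ⟩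
  ∣ q ∣                    ≡⟨ ∣p∣≡∣p∩q∣+∣p∩∁q∣ q p ⟩
  ∣ q ∩ p ∣ + ∣ q ∩ ∁ p ∣  ≡⟨ cong (λ r → ∣ r ∣ + ∣ q ∩ ∁ p ∣) (∩-comm q p) ⟩
  ∣ p ∩ q ∣ + ∣ q ∩ ∁ p ∣  ∎)
  where open ≡-Reasoning

x∈p∧x∉q⇒x∈p∩∁q : {p q : Subset n} {x : Fin n} → x ∈ p → x ∉ q → x ∈ p ∩ ∁ q
x∈p∧x∉q⇒x∈p∩∁q x∈p x∉q = x∈p∩q⁺ (x∈p , x∉p⇒x∈∁p x∉q)

x∈p∩∁q⁻ : (p q : Subset n) {x : Fin n} → x ∈ p ∩ ∁ q → x ∈ p × x ∉ q
x∈p∩∁q⁻ p q x∈ with x∈p , x∈∁q ← x∈p∩q⁻ p (∁ q) x∈ = x∈p , x∈∁p⇒x∉p x∈∁q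

∣p∣≡0⇒x∉p : {p : Subset n} {x : Fin n} → ∣ p ∣ ≡ 0 → x ∉ p
∣p∣≡0⇒x∉p {p = p} {x} ∣p∣≡0 x∈p = n≮0 (subst (∣ p ∖⁅ x ⁆ ∣ <_) ∣p∣≡0 (x∈p⇒∣p-x∣<∣p∣ x∈p))

∣p∩∁q∣≡0⇒p⊆q : (p q : Subset n) → ∣ p ∩ ∁ q ∣ ≡ 0 → ∀ {x} → x ∈ p → x ∈ q
∣p∩∁q∣≡0⇒p⊆q p q e {x} x∈p =
  decidable-stable (x ∈? q) λ x∉q → ∣p∣≡0⇒x∉p e (x∈p∧x∉q⇒x∈p∩∁q x∈p x∉q)

∣p∣>0⇒Nonempty : (p : Subset n) → 1 ≤ ∣ p ∣ → Nonempty p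
∣p∣>0⇒Nonempty {n} p 1≤∣p∣ = decidable-stable (nonempty? p) λ empty →
  n>0⇒n≢0 1≤∣p∣ (trans (cong ∣_∣ (Empty-unique empty)) (∣⊥∣≡0 n))

x∉p⇒p-x≡p : {p : Subset n} {x : Fin n} → x ∉ p → p ∖⁅ x ⁆ ≡ p
x∉p⇒p-x≡p {p = p} {x} x∉p = ⊆-antisym (p─q⊆p p ⁅ x ⁆)
  λ y∈p → x∈p∧x≢y⇒x∈p-y y∈p λ { refl → x∉p y∈p }

x∉p⇒∣p∣<∣p∪⁅x⁆∣ : {p : Subset n} {x : Fin n} → x ∉ p → ∣ p ∣ < ∣ p ∪ ⁅ x ⁆ ∣
x∉p⇒∣p∣<∣p∪⁅x⁆∣ {p = p} {x} x∉p =
  p⊂q⇒∣p∣<∣q∣ (p⊆p∪q ⁅ x ⁆ , x , q⊆p∪q p ⁅ x ⁆ (x∈⁅x⁆ x) , x∉p)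

x∈p∪⁅y⁆⁻ : (p : Subset n) {x y : Fin n} → x ∈ p ∪ ⁅ y ⁆ → x ∈ p ⊎ x ≡ y
x∈p∪⁅y⁆⁻ p {y = y} x∈ with x∈p∪q⁻ p ⁅ y ⁆ x∈
... | inj₁ x∈p = inj₁ x∈p
... | inj₂ x∈y = inj₂ (x∈⁅y⁆⇒x≡y y x∈y)

-- `σ` and `deg` count vertex sets rather than embeddings, so each path is recorded by the set of
-- its vertices.
image : (Fin k → Fin n) → Subset n
image f = tabulate λ v → does (any? λ i → f i ≟F v)

∈-image⁺ : (f : Fin k → Fin n) → ∀ i → f i ∈ image f
∈-image⁺ f i = ∈-tabulate⁺ (λ v → any? λ i → f i ≟F v) (i , refl)

∈-image⁻ : (f : Fin k → Fin n) {v : Fin n} → v ∈ image f → ∃ λ i → f i ≡ v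
∈-image⁻ f = ∈-tabulate⁻ (λ v → any? λ i → f i ≟F v)

-- Counting with duplicate-free lists

members : Subset n → List (Fin n)
members []            = []
members (inside ∷ p)  = zero ∷ map suc (members p)
members (outside ∷ p) = map suc (members p)

∈-members⁺ : {p : Subset n} {x : Fin n} → x ∈ p → x ∈ₗ members p
∈-members⁺ {p = inside ∷ _}  Data.Vec.here        = here refl
∈-members⁺ {p = inside ∷ _}  (Data.Vec.there x∈p) = there (∈-map⁺ suc (∈-members⁺ x∈p))
∈-members⁺ {p = outside ∷ _} (Data.Vec.there x∈p) = ∈-map⁺ suc (∈-members⁺ x∈p)

∈-members⁻ : (p : Subset n) {x : Fin n} → x ∈ₗ members p → x ∈ p
∈-members⁻ (inside ∷ p) (here refl) = Data.Vec.here
∈-members⁻ (inside ∷ p) (there x∈) with _ , y∈ , refl ← ∈-map⁻ suc x∈ =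
  Data.Vec.there (∈-members⁻ p y∈)
∈-members⁻ (outside ∷ p) x∈ with _ , y∈ , refl ← ∈-map⁻ suc x∈ =
  Data.Vec.there (∈-members⁻ p y∈)

members-unique : (p : Subset n) → Unique (members p)
members-unique []            = []
members-unique (inside ∷ p)  =
  All.map⁺ (All.tabulate λ _ ()) ∷ map⁺ suc-injective (members-unique p)
members-unique (outside ∷ p) = map⁺ suc-injective (members-unique p)

length-members : (p : Subset n) → length (members p) ≡ ∣ p ∣
length-members []            = refl
length-members (inside ∷ p)  = cong suc (trans (length-map suc (members p)) (length-members p))
length-members (outside ∷ p) = trans (length-map suc (members p)) (length-members p)

∈-allSubsets : (p : Subset n) → p ∈ₗ allSubsets n
∈-allSubsets []            = here refl
∈-allSubsets (inside ∷ p)  = ∈-++⁺ˡ (∈-map⁺ (inside ∷_) (∈-allSubsets p))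
∈-allSubsets (outside ∷ p) = ∈-++⁺ʳ _ (∈-map⁺ (outside ∷_) (∈-allSubsets p))

allSubsets-unique : ∀ n → Unique (allSubsets n)
allSubsets-unique zero    = [] ∷ []
allSubsets-unique (suc n) =
  ++⁺ (map⁺ (λ { refl → refl }) (allSubsets-unique n))
      (map⁺ (λ { refl → refl }) (allSubsets-unique n))
      disjoint
  where
  disjoint : ∀ {p} → ¬ (p ∈ₗ map (inside ∷_) (allSubsets n) × p ∈ₗ map (outside ∷_) (allSubsets n))
  disjoint (i , o) with _ , _ , refl ← ∈-map⁻ (inside ∷_) i with ∈-map⁻ (outside ∷_) o
  ... | _ , _ , ()

length-cartesianProduct : {A B : Set} (xs : List A) (ys : List B) →
  length (cartesianProduct xs ys) ≡ length xs * length ys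
length-cartesianProduct []       ys = refl
length-cartesianProduct (x ∷ xs) ys = trans (length-++ (map (x ,_) ys))
  (cong₂ _+_ (length-map (x ,_) ys) (length-cartesianProduct xs ys))

-- Injectivity is asked only on the entries of the list: the map sending inner vertices `(a , b)` to
-- the vertex set of the path forgets their order, so it is injective only once `a` and `b` are
-- confined to disjoint sets.
map-unique : {A B : Set} (f : A → B) {xs : List A} →
  (∀ {x y} → x ∈ₗ xs → y ∈ₗ xs → f x ≡ f y → x ≡ y) → Unique xs → Unique (map f xs)
map-unique f inj []              = []
map-unique f inj (x∉xs ∷ unique) =
  All.map⁺ (All.tabulate λ y∈xs fx≡fy →
    All.lookup x∉xs y∈xs (inj (here refl) (there y∈xs) fx≡fy))
  ∷ map-unique f (λ x∈ y∈ → inj (there x∈) (there y∈)) unique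

-- Without repetitions, having the same entries means being permutations of each other. This is the
-- bijection principle behind the count of `σ`.
unique∧set⇒length : {A : Set} {xs ys : List A} → Unique xs → Unique ys →
  (∀ {x} → x ∈ₗ xs → x ∈ₗ ys) → (∀ {x} → x ∈ₗ ys → x ∈ₗ xs) → length xs ≡ length ys
unique∧set⇒length uxs uys to from =
  ↭-length (∼bag⇒↭ (unique∧set⇒bag uxs uys (mk⇔ to from)))

#Subsets-positive⁺ : {P : Subset n → Set} (P? : U.Decidable P) → ∃ P → 1 ≤ #Subsets P?
#Subsets-positive⁺ {n} P? (X , p) with filter P? (allSubsets n) | ∈-filter⁺ P? (∈-allSubsets X) p
... | _ ∷ _ | _ = s≤s z≤n

#Subsets-positive⁻ : {P : Subset n → Set} (P? : U.Decidable P) → 1 ≤ #Subsets P? → ∃ P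
#Subsets-positive⁻ {n} P? 1≤# with filter P? (allSubsets n) in eq
... | X ∷ _ = X , proj₂ (∈-filter⁻ P? {xs = allSubsets n} (subst (X ∈ₗ_) (sym eq) (here refl)))

-- Cliques, independent sets and induced four-vertex paths

fourPath : (u a b v : Fin n) → Fin 4 → Fin n
fourPath u a b v = lookup (u ∷ a ∷ b ∷ v ∷ [])

module _ (G : Graph (Fin n)) where
  open Graph G

  ∈-N⁺ : ∀ {v w} → v ~ w → w ∈ N G v
  ∈-N⁺ {v} = ∈-tabulate⁺ (v ~?_)

  ∈-N⁻ : ∀ {v w} → w ∈ N G v → v ~ w
  ∈-N⁻ {v} = ∈-tabulate⁻ (v ~?_)

  -- With its independent counterpart below, this turns a swing vertex into a clique larger than `K`
  -- or an independent set larger than `I`.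
  ∪⁅⁆-clique : ∀ {X v} → IsClique G X → (∀ {x} → x ∈ X → v ~ x) → IsClique G (X ∪ ⁅ v ⁆)
  ∪⁅⁆-clique {X} X-clique v~X x y x∈ y∈ x≢y with x∈p∪⁅y⁆⁻ X x∈ | x∈p∪⁅y⁆⁻ X y∈
  ... | inj₁ x∈X  | inj₁ y∈X  = X-clique x y x∈X y∈X x≢y
  ... | inj₁ x∈X  | inj₂ refl = ~-sym (v~X x∈X)
  ... | inj₂ refl | inj₁ y∈X  = v~X y∈X
  ... | inj₂ refl | inj₂ refl = contradiction refl x≢y

  ∪⁅⁆-independent : ∀ {X v} → IsIndependent G X → (∀ {x} → x ∈ X → ¬ (v ~ x)) →
    IsIndependent G (X ∪ ⁅ v ⁆)
  ∪⁅⁆-independent {X} {v} X-independent v≁X x y x∈ y∈ x~y with x∈p∪⁅y⁆⁻ X x∈ | x∈p∪⁅y⁆⁻ X y∈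
  ... | inj₁ x∈X  | inj₁ y∈X  = X-independent x y x∈X y∈X x~y
  ... | inj₁ x∈X  | inj₂ refl = v≁X x∈X (~-sym x~y)
  ... | inj₂ refl | inj₁ y∈X  = v≁X y∈X x~y
  ... | inj₂ refl | inj₂ refl = ~-irrefl v x~y

  -- The adjacency pattern already forces the four vertices to be distinct: consecutive ones by
  -- irreflexivity, and any other coincidence would turn one of the edges into one of the forbidden
  -- ones.
  fourPath-induced : ∀ {u a b v} → u ~ a → a ~ b → b ~ v →
    ¬ (u ~ b) → ¬ (a ~ v) → ¬ (u ~ v) → IsInducedEmbedding (Path 4) G (fourPath u a b v)
  fourPath-induced {u} {a} {b} {v} u~a a~b b~v u≁b a≁v u≁v = inj , adj
    where
    f = fourPath u a b v

    u≢b : u ≢ b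
    u≢b refl = u≁v b~v
    u≢v : u ≢ v
    u≢v refl = u≁b (~-sym b~v)
    a≢v : a ≢ v
    a≢v refl = u≁v u~a

    ~⇒≢ : ∀ {x y} → x ~ y → x ≢ y
    ~⇒≢ x~y refl = ~-irrefl _ x~y

    inj : ∀ {i j} → f i ≡ f j → i ≡ j
    inj {0F} {0F} _ = refl
    inj {0F} {1F} e = contradiction e (~⇒≢ u~a)
    inj {0F} {2F} e = contradiction e u≢b
    inj {0F} {3F} e = contradiction e u≢v
    inj {1F} {0F} e = contradiction (sym e) (~⇒≢ u~a)
    inj {1F} {1F} _ = refl
    inj {1F} {2F} e = contradiction e (~⇒≢ a~b)
    inj {1F} {3F} e = contradiction e a≢v
    inj {2F} {0F} e = contradiction (sym e) u≢b
    inj {2F} {1F} e = contradiction (sym e) (~⇒≢ a~b)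
    inj {2F} {2F} _ = refl
    inj {2F} {3F} e = contradiction e (~⇒≢ b~v)
    inj {3F} {0F} e = contradiction (sym e) u≢v
    inj {3F} {1F} e = contradiction (sym e) a≢v
    inj {3F} {2F} e = contradiction (sym e) (~⇒≢ b~v)
    inj {3F} {3F} _ = refl

    adj : ∀ i j → Graph._~_ (Path 4) i j ⇔ f i ~ f j
    adj 0F 0F = mk⇔ (λ ()) (⊥-elim ∘ ~-irrefl u)
    adj 0F 1F = mk⇔ (λ _ → u~a) (λ _ → refl)
    adj 0F 2F = mk⇔ (λ ()) (⊥-elim ∘ u≁b)
    adj 0F 3F = mk⇔ (λ ()) (⊥-elim ∘ u≁v)
    adj 1F 0F = mk⇔ (λ _ → ~-sym u~a) (λ _ → refl)
    adj 1F 1F = mk⇔ (λ ()) (⊥-elim ∘ ~-irrefl a)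
    adj 1F 2F = mk⇔ (λ _ → a~b) (λ _ → refl)
    adj 1F 3F = mk⇔ (λ ()) (⊥-elim ∘ a≁v)
    adj 2F 0F = mk⇔ (λ ()) (⊥-elim ∘ u≁b ∘ ~-sym)
    adj 2F 1F = mk⇔ (λ _ → ~-sym a~b) (λ _ → refl)
    adj 2F 2F = mk⇔ (λ ()) (⊥-elim ∘ ~-irrefl b)
    adj 2F 3F = mk⇔ (λ _ → b~v) (λ _ → refl)
    adj 3F 0F = mk⇔ (λ ()) (⊥-elim ∘ u≁v ∘ ~-sym)
    adj 3F 1F = mk⇔ (λ ()) (⊥-elim ∘ a≁v ∘ ~-sym)
    adj 3F 2F = mk⇔ (λ _ → ~-sym b~v) (λ _ → refl)
    adj 3F 3F = mk⇔ (λ ()) (⊥-elim ∘ ~-irrefl v)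

-- Neighbourhoods and induced paths in split graphs

module _ (S : SplitGraph n) where
  open SplitGraph S
  open Graph graph

  private
    N′ : Fin n → Subset n
    N′ = N graph

  v∈K⊎v∈I : ∀ v → v ∈ K ⊎ v ∈ I
  v∈K⊎v∈I v = x∈p∪q⁻ K I (subst (v ∈_) (sym covers) ∈⊤)

  v∈I⇒v∉K : ∀ {v} → v ∈ I → v ∉ K
  v∈I⇒v∉K v∈I v∈K = ∉⊥ (subst (_ ∈_) disjoint (x∈p∩q⁺ (v∈K , v∈I)))

  v∉I⇒v∈K : ∀ {v} → v ∉ I → v ∈ K
  v∉I⇒v∈K {v} v∉I with v∈K⊎v∈I v
  ... | inj₁ v∈K = v∈K
  ... | inj₂ v∈I = contradiction v∈I v∉I

  v∈I∧v~w⇒w∈K : ∀ {v w} → v ∈ I → v ~ w → w ∈ K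
  v∈I∧v~w⇒w∈K v∈I v~w = v∉I⇒v∈K λ w∈I → I-independent _ _ v∈I w∈I v~w

  N⊆K : ∀ {v} → v ∈ I → ∀ {w} → w ∈ N′ v → w ∈ K
  N⊆K v∈I w∈N = v∈I∧v~w⇒w∈K v∈I (∈-N⁻ graph w∈N)

  -- Vertices of `I` are not adjacent, so the deletions in the definition of twins change nothing.
  twins⇔N≡N : ∀ {u v} → u ∈ I → v ∈ I → Twins graph u v ⇔ N′ u ≡ N′ v
  twins⇔N≡N {u} {v} u∈I v∈I = mk⇔
    (λ tw → trans (sym N-v) (trans tw N-u))
    (λ eq → trans N-v (trans eq (sym N-u)))
    where
    N-v : N′ u ∖⁅ v ⁆ ≡ N′ u
    N-v = x∉p⇒p-x≡p (I-independent u v u∈I v∈I ∘ ∈-N⁻ graph)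
    N-u : N′ v ∖⁅ u ⁆ ≡ N′ v
    N-u = x∉p⇒p-x≡p (I-independent v u v∈I u∈I ∘ ∈-N⁻ graph)

  module _ {f : Fin 4 → Fin n} (emb : IsInducedEmbedding (Path 4) graph f) where
    private
      edge : ∀ i j → Graph._~_ (Path 4) i j → f i ~ f j
      edge i j = Equivalence.to (proj₂ emb i j)
      nonedge : ∀ i j → ¬ Graph._~_ (Path 4) i j → ¬ (f i ~ f j)
      nonedge i j i≁j = i≁j ∘ Equivalence.from (proj₂ emb i j)

    -- An inner vertex in `I` would have both its path neighbours in `K`, where they are adjacent;
    -- in an induced path they are not.
    P₄-inner₁∉I : f 1F ∉ I
    P₄-inner₁∉I f1∈I = nonedge 0F 2F (λ ())
      (K-clique _ _ (v∈I∧v~w⇒w∈K f1∈I (edge 1F 0F refl)) (v∈I∧v~w⇒w∈K f1∈I (edge 1F 2F refl))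
        λ e → contradiction (proj₁ emb e) λ ())

    P₄-inner₂∉I : f 2F ∉ I
    P₄-inner₂∉I f2∈I = nonedge 1F 3F (λ ())
      (K-clique _ _ (v∈I∧v~w⇒w∈K f2∈I (edge 2F 1F refl)) (v∈I∧v~w⇒w∈K f2∈I (edge 2F 3F refl))
        λ e → contradiction (proj₁ emb e) λ ())

    P₄-differences : f 1F ∈ N′ (f 0F) ∩ ∁ (N′ (f 3F)) × f 2F ∈ N′ (f 3F) ∩ ∁ (N′ (f 0F))
    P₄-differences =
        x∈p∧x∉q⇒x∈p∩∁q (∈-N⁺ graph (edge 0F 1F refl)) (nonedge 3F 1F (λ ()) ∘ ∈-N⁻ graph)
      , x∈p∧x∉q⇒x∈p∩∁q (∈-N⁺ graph (edge 3F 2F refl)) (nonedge 0F 2F (λ ()) ∘ ∈-N⁻ graph)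

  -- Counting the induced paths through two vertices of the independent side

  module _ {u v : Fin n} (u∈I : u ∈ I) (v∈I : v ∈ I) (u≢v : u ≢ v) where
    private
      A B : Subset n
      A = N′ u ∩ ∁ (N′ v)
      B = N′ v ∩ ∁ (N′ u)

      pathSet : Fin n × Fin n → Subset n
      pathSet (a , b) = image (fourPath u a b v)

      pathSets : List (Subset n)
      pathSets = map pathSet (cartesianProduct (members A) (members B))

      ∈-product⁻ : ∀ {a b} → (a , b) ∈ₗ cartesianProduct (members A) (members B) → a ∈ A × b ∈ B
      ∈-product⁻ ab∈ with a∈ , b∈ ← ∈-cartesianProduct⁻ (members A) (members B) ab∈ =
        ∈-members⁻ A a∈ , ∈-members⁻ B b∈

      K≢I : ∀ {x y} → x ∈ K → y ∈ I → x ≢ y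
      K≢I x∈K y∈I refl = v∈I⇒v∉K y∈I x∈K

      A⊆N : ∀ {x} → x ∈ A → x ∈ N′ u × x ∉ N′ v
      A⊆N = x∈p∩∁q⁻ (N′ u) (N′ v)
      B⊆N : ∀ {x} → x ∈ B → x ∈ N′ v × x ∉ N′ u
      B⊆N = x∈p∩∁q⁻ (N′ v) (N′ u)

      A≢B : ∀ {x y} → x ∈ A → y ∈ B → x ≢ y
      A≢B x∈A y∈B refl = proj₂ (A⊆N x∈A) (proj₁ (B⊆N y∈B))

      -- The vertex set determines `a` as its only element in `A`: the ends `u`, `v` lie in `I`
      -- while `a` lies in `K`, and `B` is disjoint from `A`. The same holds for `b` in `B`.
      pathSet-injective : ∀ {a b a′ b′} → a ∈ A → b ∈ B → a′ ∈ A → b′ ∈ B →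
        pathSet (a , b) ≡ pathSet (a′ , b′) → (a , b) ≡ (a′ , b′)
      pathSet-injective {a} {b} {a′} {b′} a∈A b∈B a′∈A b′∈B eq = cong₂ _,_ a≡a′ b≡b′
        where
        a∈K = N⊆K u∈I (proj₁ (A⊆N a∈A))
        b∈K = N⊆K v∈I (proj₁ (B⊆N b∈B))
        transport : ∀ i → ∃ λ j → fourPath u a′ b′ v j ≡ fourPath u a b v i
        transport i = ∈-image⁻ (fourPath u a′ b′ v)
          (subst (_ ∈_) eq (∈-image⁺ (fourPath u a b v) i))
        a≡a′ : a ≡ a′
        a≡a′ with transport 1F
        ... | 0F , u≡a  = contradiction (sym u≡a) (K≢I a∈K u∈I)
        ... | 1F , a′≡a = sym a′≡a
        ... | 2F , b′≡a = contradiction (sym b′≡a) (A≢B a∈A b′∈B)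
        ... | 3F , v≡a  = contradiction (sym v≡a) (K≢I a∈K v∈I)
        b≡b′ : b ≡ b′
        b≡b′ with transport 2F
        ... | 0F , u≡b  = contradiction (sym u≡b) (K≢I b∈K u∈I)
        ... | 1F , a′≡b = contradiction a′≡b (A≢B a′∈A b∈B)
        ... | 2F , b′≡b = sym b′≡b
        ... | 3F , v≡b  = contradiction (sym v≡b) (K≢I b∈K v∈I)

      ∈-pathSets⁺ : ∀ {a b} → a ∈ A → b ∈ B → pathSet (a , b) ∈ₗ pathSets
      ∈-pathSets⁺ a∈A b∈B =
        ∈-map⁺ pathSet (∈-cartesianProduct⁺ (∈-members⁺ a∈A) (∈-members⁺ b∈B))

      pathSet-P₄ : ∀ {a b} → a ∈ A → b ∈ B → InducedOn graph (Path 4) (pathSet (a , b))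
      pathSet-P₄ {a} {b} a∈A b∈B =
          fourPath u a b v
        , fourPath-induced graph
            (∈-N⁻ graph a∈Nu)
            (K-clique a b (N⊆K u∈I a∈Nu) (N⊆K v∈I b∈Nv) (A≢B a∈A b∈B))
            (~-sym (∈-N⁻ graph b∈Nv))
            (b∉Nu ∘ ∈-N⁺ graph)
            (a∉Nv ∘ ∈-N⁺ graph ∘ ~-sym)
            (I-independent u v u∈I v∈I)
        , λ _ → mk⇔ (∈-image⁻ (fourPath u a b v)) λ { (i , refl) → ∈-image⁺ (fourPath u a b v) i }
        where
        a∈Nu = proj₁ (A⊆N a∈A)
        a∉Nv = proj₂ (A⊆N a∈A)
        b∈Nv = proj₁ (B⊆N b∈B)
        b∉Nu = proj₂ (B⊆N b∈B)

      pathSet∈ : ∀ {a b} → a ∈ A → b ∈ B → pathSet (a , b) ∈ₗ filter (σ? u v) (allSubsets n)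
      pathSet∈ {a} {b} a∈A b∈B = ∈-filter⁺ (σ? u v) (∈-allSubsets (pathSet (a , b)))
        ((∈-image⁺ path 0F , ∈-image⁺ path 3F) , pathSet-P₄ a∈A b∈B)
        where
        path : Fin 4 → Fin n
        path = fourPath u a b v

      -- As no inner vertex of the path lies in `I`, the vertices `u` and `v` are its two ends, in
      -- one order or the other.
      P₄∈pathSets : ∀ {X} → u ∈ X → v ∈ X → InducedOn graph (Path 4) X → X ∈ₗ pathSets
      P₄∈pathSets {X} u∈X v∈X (f , emb , im)
        with i , fi≡u ← Equivalence.to (im u) u∈X
           | j , fj≡v ← Equivalence.to (im v) v∈X = go i j fi≡u fj≡v
        where
        -- The reindexing `τ` gives the inclusion of `image g` in `X`, and `ρ` the reverse one.
        X≡image : (g : Fin 4 → Fin n) (ρ τ : Fin 4 → Fin 4) →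
          (∀ i → g (ρ i) ≡ f i) → (∀ i → f (τ i) ≡ g i) → image g ≡ X
        X≡image g ρ τ gρ fτ = ⊆-antisym
          (λ {w} w∈ → let (i , gi≡w) = ∈-image⁻ g w∈ in
            Equivalence.from (im w) (τ i , trans (fτ i) gi≡w))
          (λ {w} w∈ → let (i , fi≡w) = Equivalence.to (im w) w∈ in
            subst (_∈ image g) (trans (gρ i) fi≡w) (∈-image⁺ g (ρ i)))

        fourPath-η : ∀ i → fourPath (f 0F) (f 1F) (f 2F) (f 3F) i ≡ f i
        fourPath-η 0F = refl
        fourPath-η 1F = refl
        fourPath-η 2F = refl
        fourPath-η 3F = refl

        fourPath-reverse : ∀ i → fourPath (f 3F) (f 2F) (f 1F) (f 0F) i ≡ f (opposite i)
        fourPath-reverse 0F = refl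
        fourPath-reverse 1F = refl
        fourPath-reverse 2F = refl
        fourPath-reverse 3F = refl

        fourPath-reverse′ : ∀ i → fourPath (f 3F) (f 2F) (f 1F) (f 0F) (opposite i) ≡ f i
        fourPath-reverse′ 0F = refl
        fourPath-reverse′ 1F = refl
        fourPath-reverse′ 2F = refl
        fourPath-reverse′ 3F = refl

        go : ∀ i j → f i ≡ u → f j ≡ v → X ∈ₗ pathSets
        go 1F _  refl _    = contradiction u∈I (P₄-inner₁∉I emb)
        go 2F _  refl _    = contradiction u∈I (P₄-inner₂∉I emb)
        go 0F 1F _    refl = contradiction v∈I (P₄-inner₁∉I emb)
        go 0F 2F _    refl = contradiction v∈I (P₄-inner₂∉I emb)
        go 3F 1F _    refl = contradiction v∈I (P₄-inner₁∉I emb)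
        go 3F 2F _    refl = contradiction v∈I (P₄-inner₂∉I emb)
        go 0F 0F refl refl = contradiction refl u≢v
        go 3F 3F refl refl = contradiction refl u≢v
        go 0F 3F refl refl with a∈A , b∈B ← P₄-differences emb =
          subst (_∈ₗ pathSets)
            (X≡image _ (λ i → i) (λ i → i) fourPath-η (sym ∘ fourPath-η))
            (∈-pathSets⁺ a∈A b∈B)
        -- Here the embedding runs from `v` to `u`, so the path is read backwards and the two
        -- differences change places.
        go 3F 0F refl refl with b∈B , a∈A ← P₄-differences emb =
          subst (_∈ₗ pathSets)
            (X≡image _ opposite opposite fourPath-reverse′ (sym ∘ fourPath-reverse))
            (∈-pathSets⁺ a∈A b∈B)

    -- Two duplicate-free lists with the same entries are compared: the subsets selected by `σ?`,
    -- and the path sets indexed by the product of the two differences.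
    σ≡∣N∖N∣*∣N∖N∣ : σ u v ≡ ∣ N′ u ∩ ∁ (N′ v) ∣ * ∣ N′ v ∩ ∁ (N′ u) ∣
    σ≡∣N∖N∣*∣N∖N∣ = begin
      σ u v
        ≡⟨ unique∧set⇒length
             (filter⁺ (σ? u v) (allSubsets-unique n))
             (map-unique pathSet
               (λ x∈ y∈ → let (a∈ , b∈) = ∈-product⁻ x∈ ; (a′∈ , b′∈) = ∈-product⁻ y∈ in
                 pathSet-injective a∈ b∈ a′∈ b′∈)
               (cartesianProduct⁺ (members-unique A) (members-unique B)))
             to from ⟩
      length pathSets
        ≡⟨ length-map pathSet (cartesianProduct (members A) (members B)) ⟩
      length (cartesianProduct (members A) (members B))
        ≡⟨ length-cartesianProduct (members A) (members B) ⟩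
      length (members A) * length (members B)
        ≡⟨ cong₂ _*_ (length-members A) (length-members B) ⟩
      ∣ A ∣ * ∣ B ∣ ∎
      where
      open ≡-Reasoning
      to : ∀ {X} → X ∈ₗ filter (σ? u v) (allSubsets n) → X ∈ₗ pathSets
      to X∈ with _ , (u∈X , v∈X) , p₄ ← ∈-filter⁻ (σ? u v) {xs = allSubsets n} X∈ =
        P₄∈pathSets u∈X v∈X p₄
      from : ∀ {X} → X ∈ₗ pathSets → X ∈ₗ filter (σ? u v) (allSubsets n)
      from X∈ =
        let
          (_ , ab∈ , X≡) = ∈-map⁻ pathSet X∈
          (a∈A , b∈B)    = ∈-product⁻ ab∈
        in subst (_∈ₗ filter (σ? u v) (allSubsets n)) (sym X≡) (pathSet∈ a∈A b∈B)

  -- Consequences of balancedness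

  module _ (balanced : Balanced) where

    -- The given vertex is a clique of size one, so the clique number is positive.
    K-nonempty : Fin n → Nonempty K
    K-nonempty v = ∣p∣>0⇒Nonempty K (proj₂ (proj₁ balanced) 1 (⁅ v ⁆ , singleton , ∣⁅x⁆∣≡1 v))
      where
      singleton : IsClique graph ⁅ v ⁆
      singleton x y x∈ y∈ x≢y =
        contradiction (trans (x∈⁅y⁆⇒x≡y v x∈) (sym (x∈⁅y⁆⇒x≡y v y∈))) x≢y

    I-nonempty : Fin n → Nonempty I
    I-nonempty v = ∣p∣>0⇒Nonempty I (proj₂ (proj₂ balanced) 1 (⁅ v ⁆ , singleton , ∣⁅x⁆∣≡1 v))
      where
      singleton : IsIndependent graph ⁅ v ⁆
      singleton x y x∈ y∈ x~y with refl ← x∈⁅y⁆⇒x≡y v x∈ with refl ← x∈⁅y⁆⇒x≡y v y∈ =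
        ~-irrefl v x~y

    -- Otherwise `K ∪ ⁅ v ⁆` would be a clique larger than the clique number.
    I-not-swing : ∀ {v} → v ∈ I → ∃ λ k → k ∈ K × ¬ (v ~ k)
    I-not-swing {v} v∈I = decidable-stable (any? λ k → (k ∈? K) ×-dec ¬? (v ~? k)) λ none →
      let
        v~K : ∀ {k} → k ∈ K → v ~ k
        v~K {k} k∈K = decidable-stable (v ~? k) λ v≁k → none (k , k∈K , v≁k)
      in <⇒≱ (x∉p⇒∣p∣<∣p∪⁅x⁆∣ (v∈I⇒v∉K v∈I))
             (proj₂ (proj₁ balanced) _ (_ , ∪⁅⁆-clique graph K-clique v~K , refl))

    -- Otherwise `I ∪ ⁅ k ⁆` would be an independent set larger than the independence number.
    K-not-swing : ∀ {k} → k ∈ K → ∃ λ v → v ∈ I × v ~ k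
    K-not-swing {k} k∈K = decidable-stable (any? λ v → (v ∈? I) ×-dec (v ~? k)) λ none →
      <⇒≱ (x∉p⇒∣p∣<∣p∪⁅x⁆∣ λ k∈I → v∈I⇒v∉K k∈I k∈K)
          (proj₂ (proj₂ balanced) _
            (_ , ∪⁅⁆-independent graph I-independent (λ v∈I k~v → none (_ , v∈I , ~-sym k~v)) , refl))

    -- A vertex `k` of `K` that `u` misses has a neighbour `w` in `I`, and `k` tells the two
    -- neighbourhoods apart.
    ∃N≢N : ∀ {u} → u ∈ I → ∃ λ w → w ∈ I × N′ w ≢ N′ u
    ∃N≢N u∈I =
      let
        (k , k∈K , u≁k) = I-not-swing u∈I
        (w , w∈I , w~k) = K-not-swing k∈K
      in w , w∈I , λ Nw≡Nu → u≁k (∈-N⁻ graph (subst (k ∈_) Nw≡Nu (∈-N⁺ graph w~k)))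

    common-degree≢0 : Fin n → ∀ d → (∀ v → v ∈ I → degree graph v ≡ d) → d ≢ 0
    common-degree≢0 x d deg≡d refl =
      let
        (k , k∈K)       = K-nonempty x
        (v , v∈I , v~k) = K-not-swing k∈K
      in ∣p∣≡0⇒x∉p (deg≡d v v∈I) (∈-N⁺ graph v~k)

    -- Some vertex of `K` is missed by `v`, so `N v` is a proper subset of `K`.
    common-degree≢∣K∣ : Fin n → ∀ d → (∀ v → v ∈ I → degree graph v ≡ d) → d ≢ ∣ K ∣
    common-degree≢∣K∣ x d deg≡d d≡∣K∣ =
      let
        (v , v∈I)       = I-nonempty x
        (k , k∈K , v≁k) = I-not-swing v∈I
      in <⇒≢ (p⊂q⇒∣p∣<∣q∣ (N⊆K v∈I , k , k∈K , v≁k ∘ ∈-N⁻ graph)) (trans (deg≡d v v∈I) d≡∣K∣)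

  -- Values of `σ` in homogeneous split graphs

  module _ (homogeneous : Homogeneous) where

    ∣N∖N∣-sym : ∀ {u v} → u ∈ I → v ∈ I → ∣ N′ u ∩ ∁ (N′ v) ∣ ≡ ∣ N′ v ∩ ∁ (N′ u) ∣
    ∣N∖N∣-sym {u} {v} u∈I v∈I =
      ∣p∣≡∣q∣⇒∣p∩∁q∣≡∣q∩∁p∣ (N′ u) (N′ v) (proj₂ homogeneous u v u∈I v∈I)

    σ-square : ∀ {u v} → u ∈ I → v ∈ I → u ≢ v → σ u v ≡ ∣ N′ u ∩ ∁ (N′ v) ∣ ^ 2
    σ-square {u} {v} u∈I v∈I u≢v = trans (σ≡∣N∖N∣*∣N∖N∣ u∈I v∈I u≢v)
      -- The power `m ^ 2` unfolds to `m * (m * 1)`, which accounts for the unit law.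
      (cong (m *_) (trans (sym (∣N∖N∣-sym u∈I v∈I)) (sym (*-identityʳ m))))
      where m = ∣ N′ u ∩ ∁ (N′ v) ∣

    σ≡0⇔N≡N : ∀ {u v} → u ∈ I → v ∈ I → u ≢ v → σ u v ≡ 0 ⇔ N′ u ≡ N′ v
    σ≡0⇔N≡N {u} {v} u∈I v∈I u≢v = mk⇔ to from
      where
      to : σ u v ≡ 0 → N′ u ≡ N′ v
      to σ≡0 = ⊆-antisym (∣p∩∁q∣≡0⇒p⊆q _ _ m≡0)
                         (∣p∩∁q∣≡0⇒p⊆q _ _ (trans (sym (∣N∖N∣-sym u∈I v∈I)) m≡0))
        where
        m≡0 : ∣ N′ u ∩ ∁ (N′ v) ∣ ≡ 0
        -- One factor of the product vanishes; the two have equal size, so the first vanishes in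
        -- either case.
        m≡0 = [ (λ e → e) , trans (∣N∖N∣-sym u∈I v∈I) ]′
          (m*n≡0⇒m≡0∨n≡0 ∣ N′ u ∩ ∁ (N′ v) ∣ (trans (sym (σ≡∣N∖N∣*∣N∖N∣ u∈I v∈I u≢v)) σ≡0))
      from : N′ u ≡ N′ v → σ u v ≡ 0
      from eq = trans (σ-square u∈I v∈I u≢v) (cong (_^ 2) (begin
        ∣ N′ u ∩ ∁ (N′ v) ∣  ≡⟨ cong (λ p → ∣ p ∩ ∁ (N′ v) ∣) eq ⟩
        ∣ N′ v ∩ ∁ (N′ v) ∣  ≡⟨ cong ∣_∣ (∩-inverseʳ (N′ v)) ⟩
        ∣ ⊥ {n} ∣            ≡⟨ ∣⊥∣≡0 n ⟩
        0                    ∎))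
        where open ≡-Reasoning

    -- The factor graph as a complete multipartite graph

    private
      module Φ = Graph Φ

      nbhd : (∃ λ v → v ∈ I) → Subset n
      nbhd (v , _) = N′ v

    Φ-adjacent⁻ : ∀ x y → x Φ.~ y → nbhd x ≢ nbhd y
    -- The multiplicity is defined by cases on this same test, and computes only once it is decided.
    Φ-adjacent⁻ (u , u∈I) (v , v∈I) x~y eq with u ≟F v
    Φ-adjacent⁻ (u , u∈I) (v , v∈I) () eq | yes _
    ... | no u≢v = n>0⇒n≢0 x~y (Equivalence.from (σ≡0⇔N≡N u∈I v∈I u≢v) eq)

    Φ-adjacent⁺ : ∀ x y → nbhd x ≢ nbhd y → x Φ.~ y
    Φ-adjacent⁺ (u , u∈I) (v , v∈I) N≢N with u ≟F v
    ... | yes refl = contradiction refl N≢N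
    ... | no u≢v   = n≢0⇒n>0 (N≢N ∘ Equivalence.to (σ≡0⇔N≡N u∈I v∈I u≢v))

    Φ-nonadjacent : ∀ x y → ¬ (x Φ.~ y) → nbhd x ≡ nbhd y
    Φ-nonadjacent x y x≁y = decidable-stable (nbhd x ≟ˢ nbhd y) (x≁y ∘ Φ-adjacent⁺ x y)

    -- Non-adjacency is equality of neighbourhoods, hence transitive. Both forbidden induced
    -- subgraphs are excluded by exhibiting a vertex that misses both ends of an edge.
    Φ-nonadjacent-trans : ∀ x y z → ¬ (x Φ.~ y) → ¬ (y Φ.~ z) → ¬ (x Φ.~ z)
    Φ-nonadjacent-trans x y z x≁y y≁z x~z =
      Φ-adjacent⁻ x z x~z (trans (Φ-nonadjacent x y x≁y) (Φ-nonadjacent y z y≁z))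

    -- Two vertices of `I` with different neighbourhoods have nonzero `σ`, and a path counted there
    -- is also counted by `deg`.
    1≤deg : Fin n → 1 ≤ deg
    1≤deg x =
      let
        (u , u∈I)         = I-nonempty (proj₁ homogeneous) x
        (w , w∈I , Nw≢Nu) = ∃N≢N (proj₁ homogeneous) u∈I
        σ≢0               = Nw≢Nu ∘ Equivalence.to (σ≡0⇔N≡N w∈I u∈I (Nw≢Nu ∘ cong N′))
        (X , _ , p₄)      = #Subsets-positive⁻ (σ? w u) (n≢0⇒n>0 σ≢0)
      in #Subsets-positive⁺ (inducedOn? graph (Path 4)) (X , p₄)

    no-induced-K₂∪K₁ : ¬ HasInducedSubgraph Φ (Complete 2 ∪̇ Complete 1)
    no-induced-K₂∪K₁ (f , _ , adj) =
      Φ-nonadjacent-trans (f (inj₁ 0F)) (f (inj₂ 0F)) (f (inj₁ 1F))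
        (λ e → contradiction (Equivalence.from (adj (inj₁ 0F) (inj₂ 0F)) e) λ ())
        (λ e → contradiction (Equivalence.from (adj (inj₂ 0F) (inj₁ 1F)) e) λ ())
        (Equivalence.to (adj (inj₁ 0F) (inj₁ 1F)) (inj₁ λ ()))

    no-induced-cycle : ∀ k → 5 ≤ k → ¬ HasInducedSubgraph Φ (Cycle k)
    no-induced-cycle (suc (suc (suc (suc (suc k))))) (s≤s (s≤s (s≤s (s≤s (s≤s _))))) (f , _ , adj) =
      -- Vertex 3 misses both ends of the edge from 0 to 1. In a cycle of length 4 it would be
      -- adjacent to 0, hence the bound 5.
      Φ-nonadjacent-trans (f 0F) (f 3F) (f 1F)
        (λ e → 0≁3 (Equivalence.from (adj 0F 3F) e))
        (λ e → 3≁1 (Equivalence.from (adj 3F 1F) e))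
        (Equivalence.to (adj 0F 1F) ((λ ()) , inj₁ refl))
      where
      0≁3 : ¬ Graph._~_ (Cycle (5 + k)) 0F 3F
      0≁3 (_ , inj₁ ())
      0≁3 (_ , inj₂ ())
      3≁1 : ¬ Graph._~_ (Cycle (5 + k)) 3F 1F
      3≁1 (_ , inj₁ ())
      3≁1 (_ , inj₂ ())

    -- Distances and diameter of the factor graph

    twins-walk : ∀ x y → nbhd x ≡ nbhd y → Walk Φ x y 2
    twins-walk x y Nx≡Ny =
      let
        (w , w∈I , Nw≢Nx) = ∃N≢N (proj₁ homogeneous) (proj₂ x)
        z : ∃ λ v → v ∈ I
        z = w , w∈I
      -- The neighbourhood of `z` differs from that of `x`, hence from the equal one of `y`, so `z`
      -- is a common neighbour.
      in _∷_ {v = z} (Φ-adjacent⁺ x z (≢-sym Nw≢Nx))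
           (Φ-adjacent⁺ z y (λ Nw≡Ny → Nw≢Nx (trans Nw≡Ny (sym Nx≡Ny))) ∷ [])

    Φ-walk : ∀ x y → ∃ λ ℓ → Walk Φ x y ℓ × ℓ ≤ 2
    Φ-walk x y with nbhd x ≟ˢ nbhd y
    ... | no Nx≢Ny  = 1 , Φ-adjacent⁺ x y Nx≢Ny ∷ [] , s≤s z≤n
    ... | yes Nx≡Ny = 2 , twins-walk x y Nx≡Ny , ≤-refl

    Φ-connected : Connected Φ
    Φ-connected x y with ℓ , walk , _ ← Φ-walk x y = ℓ , walk

    Φ-distance≤2 : ∀ d → (∃ λ x → ∃ λ y → IsDistance Φ x y d) → d ≤ 2
    Φ-distance≤2 d (x , y , _ , minimal) with ℓ , walk , ℓ≤2 ← Φ-walk x y =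
      ≤-trans (minimal ℓ walk) ℓ≤2

    -- The diameter is 2 or 1 according to whether two vertices of I share their neighbourhood.
    Φ-diameter : Fin n → ∃ λ D → IsDiameter Φ D × D ≤ 2
    Φ-diameter x₀ with
      any? (λ u → any? (λ v → (u ∈? I) ×-dec (v ∈? I) ×-dec ¬? (u ≟F v) ×-dec (N′ u ≟ˢ N′ v)))
    ... | yes (u , v , u∈I , v∈I , u≢v , Nu≡Nv) =
      2 , (Φ-connected , (x , y , twins-walk x y Nu≡Nv , minimal) , Φ-distance≤2) , ≤-refl
      where
      x y : ∃ λ v → v ∈ I
      x = u , u∈I
      y = v , v∈I

      minimal : ∀ ℓ → Walk Φ x y ℓ → 2 ≤ ℓ
      -- Length 0 would identify `u` with `v`, and length 1 would be an edge between equal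
      -- neighbourhoods.
      minimal .0 []         = contradiction refl u≢v
      minimal .1 (e ∷ [])   = contradiction Nu≡Nv (Φ-adjacent⁻ x y e)
      minimal _ (_ ∷ _ ∷ _) = s≤s (s≤s z≤n)
    ... | no no-twins =
      let
        (u , u∈I)         = I-nonempty (proj₁ homogeneous) x₀
        (w , w∈I , Nw≢Nu) = ∃N≢N (proj₁ homogeneous) u∈I
        x : ∃ λ v → v ∈ I
        x = w , w∈I
        y : ∃ λ v → v ∈ I
        y = u , u∈I
      in 1 , (Φ-connected , (x , y , Φ-adjacent⁺ x y Nw≢Nu ∷ [] , minimal x y Nw≢Nu) , maximal)
           , s≤s z≤n
      where
      minimal : ∀ x y → nbhd x ≢ nbhd y → ∀ ℓ → Walk Φ x y ℓ → 1 ≤ ℓ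
      minimal _ _ Nx≢Ny .0 [] = contradiction refl Nx≢Ny
      minimal _ _ _ _ (_ ∷ _) = s≤s z≤n

      maximal : ∀ d → (∃ λ x → ∃ λ y → IsDistance Φ x y d) → d ≤ 1
      maximal d (x@(u , u∈I) , y@(v , v∈I) , _ , min) with N′ u ≟ˢ N′ v
      ... | no N≢N = min 1 (Φ-adjacent⁺ x y N≢N ∷ [])
      ... | yes N≡N with u ≟F v
      ...   | no u≢v   = contradiction (u , v , u∈I , v∈I , u≢v , N≡N) no-twins
      -- Vertices of `Φ` carry a membership proof; uniqueness of that proof makes the two vertices
      -- equal, so the empty walk applies.
      ...   | yes refl with refl ← []=-irrelevant u∈I v∈I = ≤-trans (min 0 []) z≤n

theorem3p2 : (n : ℕ) → NonZero n → (S : SplitGraph n) →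
    let open SplitGraph S in
    Homogeneous →
    (∀ u v → u ∈ I → v ∈ I → u ≢ v → (σ u v ≡ 0) ⇔ Twins graph u v)
    × (∀ u v → u ∈ I → v ∈ I → u ≢ v → ∃ λ m → σ u v ≡ m ^ 2)
    × (1 ≤ deg × (∀ d → (∀ v → v ∈ I → degree graph v ≡ d) → d ≢ 0 × d ≢ ∣ K ∣))
    × (¬ HasInducedSubgraph Φ (Complete 2 ∪̇ Complete 1))
    × ((∃ λ D → IsDiameter Φ D × D ≤ 2) × Connected Φ)
    × (∀ k → 5 ≤ k → ¬ HasInducedSubgraph Φ (Cycle k))
theorem3p2 (suc n) _ S hom =
    (λ u v u∈I v∈I u≢v →
      ⇔-sym (twins⇔N≡N S u∈I v∈I) ⇔-∘ σ≡0⇔N≡N S hom u∈I v∈I u≢v)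
  , (λ u v u∈I v∈I u≢v → ∣ N (graph S) u ∩ ∁ (N (graph S) v) ∣ , σ-square S hom u∈I v∈I u≢v)
  -- The vertex `zero` exists because the order is a successor; it is what makes `K` and `I`
  -- nonempty.
  , (1≤deg S hom zero , λ d deg≡d → common-degree≢0 S (proj₁ hom) zero d deg≡d
                                   , common-degree≢∣K∣ S (proj₁ hom) zero d deg≡d)
  , no-induced-K₂∪K₁ S hom
  , (Φ-diameter S hom zero , Φ-connected S hom)
  , no-induced-cycle S hom
  where open SplitGraph using (graph)
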